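{- Let $Q=\{q_1,\dots,q_n\}$ be a finite set and let an arbitrary binary relation system on $Q$ be given by its $n\times n$ 0-1 matrix $L=(l_{ij})$. Then $L$ can be brought to canonical form by successive application of the $\Delta n$-transformation to those entries $l_{xy}=1$ of $L$ which do not satisfy the canonicity condition.
   Context: Canonicity condition for an entry $m_{xy}=1$ of a 0-1 matrix $M=(m_{ij})$ of order $k$: if $\sum_{i=1}^k m_{iy}>1$ then $\sum_{j=1}^k m_{xj}=1$, and if $\sum_{j=1}^k m_{xj}>1$ then $\sum_{i=1}^k m_{iy}=1$ (that is, $m_{xy}$ is the only nonzero entry of its row or the only nonzero entry of its column). $M$ is canonical (has canonical form) if every entry $m_{xy}=1$ satisfies the canonicity condition. $\Delta n$-transformation of an entry $m_{xy}=1$ of a $k\times k$ 0-1 matrix $M$: the $(k+1)\times(k+1)$ matrix obtained by adding a new row and column with index $k+1$, replacing the entry $(x,y)$ by $0$, setting the entries $(x,k+1)$ and $(k+1,y)$ equal to $1$, setting all other entries of the new row and column to $0$, and leaving all other entries unchanged. -}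

module Defs where

open import Data.Bool.Base using (if_then_else_; _∧_)
open import Data.Fin.Base using (Fin; toℕ; inject₁)
open import Data.Fin.Patterns using (0F; 1F)
open import Data.Fin.Properties using (_≟_)
open import Data.Fin.Relation.Unary.Top using (view; ‵fromℕ; ‵inject₁)
open import Data.List.Base using (List; []; _∷_; map)
open import Data.Nat.Base using (ℕ; suc; _>_)
open import Data.Nat.Properties using (+-0-monoid)
open import Data.Product.Base using (_×_; _,_)
import Data.Product.Base as Product
open import Data.Vec.Functional using (Vector)
open import Relation.Binary.PropositionalEquality.Core using (_≡_)
open import Relation.Nullary.Decidable.Core using (does)
open import Relation.Nullary.Negation.Core using (¬_)
open import Algebra.Properties.Monoid.Sum +-0-monoid using (sum-syntax)

private
  variable
    k m : ℕ

ZeroOneMatrix : ℕ → Set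
ZeroOneMatrix k = Vector (Vector (Fin 2) k) k

Position : ℕ → Set
Position k = Fin k × Fin k

rowSum : ZeroOneMatrix k → Fin k → ℕ
rowSum {k} M x = ∑[ j < k ] toℕ (M x j)

columnSum : ZeroOneMatrix k → Fin k → ℕ
columnSum {k} M y = ∑[ i < k ] toℕ (M i y)

CanonicityCondition : ZeroOneMatrix k → Position k → Set
CanonicityCondition M (x , y) =
  (columnSum M y > 1 → rowSum M x ≡ 1) × (rowSum M x > 1 → columnSum M y ≡ 1)

Canonical : ZeroOneMatrix k → Set
Canonical {k} M = ∀ (x y : Fin k) → M x y ≡ 1F → CanonicityCondition M (x , y)

NonCanonicalEntry : ZeroOneMatrix k → Position k → Set
NonCanonicalEntry M (x , y) = M x y ≡ 1F × ¬ CanonicityCondition M (x , y)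

-- The added row and column have index fromℕ k; the original index i becomes
-- inject₁ i.  Δn is only meant to be applied where M x y ≡ 1F; this is
-- enforced in _⟶[_]_ below.
Δn : ZeroOneMatrix k → Position k → ZeroOneMatrix (suc k)
Δn M (x , y) i j with view i | view j
... | ‵fromℕ     | ‵fromℕ     = 0F
... | ‵fromℕ     | ‵inject₁ j = if does (j ≟ y) then 1F else 0F
... | ‵inject₁ i | ‵fromℕ     = if does (i ≟ x) then 1F else 0F
... | ‵inject₁ i | ‵inject₁ j =
  if does (i ≟ x) ∧ does (j ≟ y) then 0F else M i j

injectPosition : Position k → Position (suc k)
injectPosition = Product.map inject₁ inject₁

infix 4 _⟶[_]_

-- L ⟶[ ps ] N: N arises from L by applying Δn successively to the entries at
-- the positions ps of L, each of which must, when its turn comes, be a 1 that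
-- violates the canonicity condition of the current matrix.  In particular ps
-- has no repetitions, since Δn turns the treated entry into 0.
data _⟶[_]_ : ZeroOneMatrix k → List (Position k) → ZeroOneMatrix m → Set where
  done : {M : ZeroOneMatrix k} → M ⟶[ [] ] M
  step : {M : ZeroOneMatrix k} {N : ZeroOneMatrix m}
         {p : Position k} {ps : List (Position k)} →
         NonCanonicalEntry M p →
         Δn M p ⟶[ map injectPosition ps ] N →
         M ⟶[ p ∷ ps ] N

{-# OPTIONS --safe #-}

-- Δn at a nonzero entry (x , y) moves the 1 of row x to the new column and the
-- 1 of column y to the new row, so all old row and column sums are unchanged,
-- while the new row and column have sum 1 and hence contain only canonical
-- entries.  Each step thus removes exactly one noncanonical entry and creates
-- none, so the noncanonical entries of L can be treated in any order.
module Submission where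

open import Defs
open import Data.Bool.Base using (if_then_else_; _∧_)
open import Data.Bool.Properties using (∧-comm)
open import Data.Fin.Base using (Fin; toℕ; fromℕ; inject₁; punchIn)
open import Data.Fin.Patterns using (0F; 1F)
open import Data.Fin.Properties using (inject₁-injective; punchInᵢ≢i)
import Data.Fin.Properties as Fin
open import Data.Fin.Relation.Unary.Top
  using (View; view; view-fromℕ; view-inject₁; ‵fromℕ; ‵inject₁)
open import Data.List.Base
  using (List; []; _∷_; map; length; filter; allFin; cartesianProduct)
open import Data.List.Membership.Propositional using (_∈_)
open import Data.List.Membership.Propositional.Properties
  using (∈-map⁺; ∈-map⁻; ∈-filter⁺; ∈-filter⁻; ∈-allFin; ∈-cartesianProduct⁺)
open import Data.List.Properties using (length-map)
open import Data.List.Relation.Unary.All using (lookup)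
open import Data.List.Relation.Unary.AllPairs using (_∷_)
open import Data.List.Relation.Unary.Any using (here; there)
open import Data.List.Relation.Unary.Unique.Propositional using (Unique)
open import Data.List.Relation.Unary.Unique.Propositional.Properties
  using (allFin⁺; cartesianProduct⁺; filter⁺; map⁺)
open import Data.Nat.Base using (ℕ; suc; _+_; _>_)
open import Data.Nat.Properties
  using (+-0-commutativeMonoid; +-identityʳ; suc-injective; <-irrefl)
import Data.Nat.Properties as ℕ
open import Data.Nat.Tactic.RingSolver using (solve)
open import Data.Product.Base using (Σ-syntax; ∃-syntax; _×_; _,_; proj₁; proj₂)
open import Data.Vec.Functional using (Vector; transpose; removeAt)
open import Algebra.Properties.CommutativeMonoid.Sum +-0-commutativeMonoid
  using (sum; sum-cong-≗; sum-init-last; sum-remove; sum-replicate-zero)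
open import Function.Base using (_∘_)
open import Function.Bundles using (_⇔_; mk⇔; module Equivalence)
open import Relation.Binary.PropositionalEquality
open import Relation.Nullary.Decidable
  using (Dec; yes; no; does; ¬?; _×-dec_; _→-dec_; decidable-stable;
         dec-true; dec-false)
open import Relation.Nullary.Negation using (contradiction)

private
  variable
    k : ℕ

-- Once the terms at `y` are split off, the remainders of both sums coincide. Adding the opposite
-- term on each side avoids truncated subtraction on `ℕ`.
sum-agreeing-off : (s t : Vector ℕ k) (y : Fin k) →
  (∀ j → j ≢ y → s j ≡ t j) → sum s + t y ≡ sum t + s y
sum-agreeing-off {suc k} s t y s≗t = begin
  sum s + t y                       ≡⟨ cong (_+ t y) (sum-remove {i = y} s) ⟩
  s y + sum (removeAt s y) + t y    ≡⟨ cong (λ r → s y + r + t y) rest ⟩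
  s y + sum (removeAt t y) + t y    ≡⟨ swap (s y) (sum (removeAt t y)) (t y) ⟩
  t y + sum (removeAt t y) + s y    ≡⟨ cong (_+ s y) (sum-remove {i = y} t) ⟨
  sum t + s y                       ∎
  where
  open ≡-Reasoning
  rest : sum (removeAt s y) ≡ sum (removeAt t y)
  rest = sum-cong-≗ (λ j → s≗t (punchIn y j) (punchInᵢ≢i y j))
  swap : ∀ a b c → a + b + c ≡ c + b + a
  swap a b c = solve (a ∷ b ∷ c ∷ [])

-- Comparison of `s` with the zero vector. It evaluates the added row, which has a single nonzero
-- entry.
sum-supported-at : (s : Vector ℕ k) (y : Fin k) →
  (∀ j → j ≢ y → s j ≡ 0) → sum s ≡ s y
sum-supported-at {k} s y s≗0 = begin
  sum s                    ≡⟨ +-identityʳ (sum s) ⟨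
  sum s + 0                ≡⟨ sum-agreeing-off s (λ _ → 0) y s≗0 ⟩
  sum {k} (λ _ → 0) + s y  ≡⟨ cong (_+ s y) (sum-replicate-zero k) ⟩
  s y                      ∎
  where open ≡-Reasoning

if-∧-≢ : ∀ {A : Set} {a b : A} {i x j y : Fin k} → (i , j) ≢ (x , y) →
  (if does (i Fin.≟ x) ∧ does (j Fin.≟ y) then a else b) ≡ b
if-∧-≢ {i = i} {x} {j} {y} ij≢xy with i Fin.≟ x | j Fin.≟ y
... | yes refl | yes refl = contradiction refl ij≢xy
... | yes _    | no _     = refl
... | no _     | _        = refl

module _ (M : ZeroOneMatrix k) (x y : Fin k) where

  Δn-old-old : ∀ i j → (i , j) ≢ (x , y) →
    Δn M (x , y) (inject₁ i) (inject₁ j) ≡ M i j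
  Δn-old-old i j ij≢xy rewrite view-inject₁ i | view-inject₁ j = if-∧-≢ ij≢xy

  Δn-treated : Δn M (x , y) (inject₁ x) (inject₁ y) ≡ 0F
  Δn-treated rewrite view-inject₁ x | view-inject₁ y
    | dec-true (x Fin.≟ x) refl | dec-true (y Fin.≟ y) refl = refl

  Δn-old-new : ∀ i →
    Δn M (x , y) (inject₁ i) (fromℕ k) ≡ (if does (i Fin.≟ x) then 1F else 0F)
  Δn-old-new i rewrite view-inject₁ i | view-fromℕ k = refl

  Δn-new-old : ∀ j →
    Δn M (x , y) (fromℕ k) (inject₁ j) ≡ (if does (j Fin.≟ y) then 1F else 0F)
  Δn-new-old j rewrite view-inject₁ j | view-fromℕ k = refl

  Δn-new-new : Δn M (x , y) (fromℕ k) (fromℕ k) ≡ 0F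
  Δn-new-new rewrite view-fromℕ k = refl

  -- The construction treats rows and columns alike; only the order of the two tests in the
  -- conjunction changes. This lets every column-sum fact be read off from a row-sum fact.
  Δn-transpose : ∀ i j →
    Δn M (x , y) j i ≡ Δn (transpose M) (y , x) i j
  Δn-transpose i j with view i | view j
  ... | ‵fromℕ     | ‵fromℕ     = refl
  ... | ‵fromℕ     | ‵inject₁ j = refl
  ... | ‵inject₁ i | ‵fromℕ     = refl
  ... | ‵inject₁ i | ‵inject₁ j =
    cong (if_then 0F else M j i) (∧-comm (does (j Fin.≟ x)) (does (i Fin.≟ y)))

  rowSum-Δn-new : rowSum (Δn M (x , y)) (fromℕ k) ≡ 1
  rowSum-Δn-new = begin
    rowSum (Δn M (x , y)) (fromℕ k)
      ≡⟨ sum-init-last (toℕ ∘ Δn M (x , y) (fromℕ k)) ⟩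
    sum s + toℕ (Δn M (x , y) (fromℕ k) (fromℕ k))
      ≡⟨ cong₂ _+_ (sum-supported-at s y off) (cong toℕ Δn-new-new) ⟩
    s y + 0
      ≡⟨ cong (_+ 0) at ⟩
    1 ∎
    where
    open ≡-Reasoning
    s : Vector ℕ k
    s j = toℕ (Δn M (x , y) (fromℕ k) (inject₁ j))
    off : ∀ j → j ≢ y → s j ≡ 0
    off j j≢y rewrite Δn-new-old j | dec-false (j Fin.≟ y) j≢y = refl
    at : s y ≡ 1
    at rewrite Δn-new-old y | dec-true (y Fin.≟ y) refl = refl

  -- A row other than `x` keeps its entries and gains a 0. Row `x` loses the 1 at `y` and regains it
  -- in the new column.
  rowSum-Δn-old : M x y ≡ 1F → ∀ i →
    rowSum (Δn M (x , y)) (inject₁ i) ≡ rowSum M i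
  rowSum-Δn-old Mxy≡1 i = trans
    (sum-init-last (toℕ ∘ Δn M (x , y) (inject₁ i)))
    (trans (cong (λ b → sum s + toℕ b) (Δn-old-new i)) (rest (i Fin.≟ x)))
    where
    open ≡-Reasoning
    s : Vector ℕ k
    s j = toℕ (Δn M (x , y) (inject₁ i) (inject₁ j))
    -- With the decision as an argument, matching on it evaluates the entry of the new column.
    rest : (i≟x : Dec (i ≡ x)) →
      sum s + toℕ {2} (if does i≟x then 1F else 0F) ≡ rowSum M i
    rest (no i≢x) = trans (+-identityʳ (sum s)) (sum-cong-≗
      (λ j → cong toℕ (Δn-old-old i j (i≢x ∘ cong proj₁))))
    rest (yes refl) = begin
      -- The 1 in the new column is read as the removed entry `M x y`, which gives the sum the shape
      -- of `sum-agreeing-off`.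
      sum s + 1            ≡⟨ cong (λ b → sum s + toℕ b) Mxy≡1 ⟨
      sum s + toℕ (M x y)  ≡⟨ sum-agreeing-off s (toℕ ∘ M x) y
                                (λ j j≢y → cong toℕ (Δn-old-old x j (j≢y ∘ cong proj₂))) ⟩
      rowSum M x + s y     ≡⟨ cong (λ b → rowSum M x + toℕ b) Δn-treated ⟩
      rowSum M x + 0       ≡⟨ +-identityʳ _ ⟩
      rowSum M x           ∎

module _ (M : ZeroOneMatrix k) (x y : Fin k) where

  columnSum-Δn : ∀ j →
    columnSum (Δn M (x , y)) j ≡ rowSum (Δn (transpose M) (y , x)) j
  columnSum-Δn j = sum-cong-≗ (cong toℕ ∘ Δn-transpose M x y j)

  columnSum-Δn-new : columnSum (Δn M (x , y)) (fromℕ k) ≡ 1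
  columnSum-Δn-new =
    trans (columnSum-Δn (fromℕ k)) (rowSum-Δn-new (transpose M) y x)

  columnSum-Δn-old : M x y ≡ 1F → ∀ j →
    columnSum (Δn M (x , y)) (inject₁ j) ≡ columnSum M j
  columnSum-Δn-old Mxy≡1 j =
    trans (columnSum-Δn (inject₁ j)) (rowSum-Δn-old (transpose M) y x Mxy≡1 j)

rowSum≡1⇒canonical : (M : ZeroOneMatrix k) (x y : Fin k) →
  rowSum M x ≡ 1 → CanonicityCondition M (x , y)
rowSum≡1⇒canonical M x y r≡1 = (λ _ → r≡1) , λ r>1 → contradiction r>1 (<-irrefl (sym r≡1))

columnSum≡1⇒canonical : (M : ZeroOneMatrix k) (x y : Fin k) →
  columnSum M y ≡ 1 → CanonicityCondition M (x , y)
columnSum≡1⇒canonical M x y c≡1 = (λ c>1 → contradiction c>1 (<-irrefl (sym c≡1))) , λ _ → c≡1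

-- The condition sees a position only through its two sums, so it transfers even between matrices of
-- different orders.
CanonicityCondition-resp : {m : ℕ} (M : ZeroOneMatrix k) (N : ZeroOneMatrix m)
  (p@(x , y) : Position k) (q@(x′ , y′) : Position m) →
  columnSum M y ≡ columnSum N y′ → rowSum M x ≡ rowSum N x′ →
  CanonicityCondition M p → CanonicityCondition N q
CanonicityCondition-resp _ _ _ _ =
  subst₂ (λ c r → (c > 1 → r ≡ 1) × (r > 1 → c ≡ 1))

canonicityCondition? : (M : ZeroOneMatrix k) (p : Position k) →
  Dec (CanonicityCondition M p)
canonicityCondition? M (x , y) =
  (columnSum M y ℕ.>? 1 →-dec rowSum M x ℕ.≟ 1) ×-dec
  (rowSum M x ℕ.>? 1 →-dec columnSum M y ℕ.≟ 1)

nonCanonicalEntry? : (M : ZeroOneMatrix k) (p : Position k) →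
  Dec (NonCanonicalEntry M p)
nonCanonicalEntry? M p@(x , y) = M x y Fin.≟ 1F ×-dec ¬? (canonicityCondition? M p)

module _ (M : ZeroOneMatrix k) {x y : Fin k} (Mxy≡1 : M x y ≡ 1F) where

  Δn-nonCanonical⁺ : ∀ {q} → q ≢ (x , y) → NonCanonicalEntry M q →
    NonCanonicalEntry (Δn M (x , y)) (injectPosition q)
  Δn-nonCanonical⁺ {i , j} q≢xy (Mij≡1 , ¬cc) =
    trans (Δn-old-old M x y i j q≢xy) Mij≡1 ,
    ¬cc ∘ CanonicityCondition-resp (Δn M (x , y)) M
            (inject₁ i , inject₁ j) (i , j)
            (columnSum-Δn-old M x y Mxy≡1 j) (rowSum-Δn-old M x y Mxy≡1 i)

  Δn-nonCanonical⁻ : ∀ {q′} → NonCanonicalEntry (Δn M (x , y)) q′ →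
    ∃[ q ] q′ ≡ injectPosition q × q ≢ (x , y) × NonCanonicalEntry M q
  Δn-nonCanonical⁻ {i′ , j′} = classify (view i′) (view j′)
    where
    -- Matching on the views turns the indices into `fromℕ` or `inject₁` form, to which the lemmas
    -- on entries and sums apply.
    classify : ∀ {i′ j′} → View i′ → View j′ →
      NonCanonicalEntry (Δn M (x , y)) (i′ , j′) →
      ∃[ q ] (i′ , j′) ≡ injectPosition q × q ≢ (x , y) × NonCanonicalEntry M q
    classify {j′ = j′} ‵fromℕ _ (_ , ¬cc) = contradiction
      (rowSum≡1⇒canonical (Δn M (x , y)) (fromℕ k) j′ (rowSum-Δn-new M x y)) ¬cc
    classify {i′} (‵inject₁ _) ‵fromℕ (_ , ¬cc) = contradiction
      (columnSum≡1⇒canonical (Δn M (x , y)) i′ (fromℕ k) (columnSum-Δn-new M x y)) ¬cc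
    classify (‵inject₁ i) (‵inject₁ j) (e≡1 , ¬cc) =
      (i , j) , refl , ij≢xy ,
      trans (sym (Δn-old-old M x y i j ij≢xy)) e≡1 ,
      ¬cc ∘ CanonicityCondition-resp M (Δn M (x , y))
              (i , j) (inject₁ i , inject₁ j)
              (sym (columnSum-Δn-old M x y Mxy≡1 j)) (sym (rowSum-Δn-old M x y Mxy≡1 i))
      where
      ij≢xy : (i , j) ≢ (x , y)
      ij≢xy refl = contradiction (trans (sym (Δn-treated M x y)) e≡1) λ ()

injectPosition-injective : {p q : Position k} →
  injectPosition p ≡ injectPosition q → p ≡ q
injectPosition-injective eq = cong₂ _,_
  (inject₁-injective (cong proj₁ eq)) (inject₁-injective (cong proj₂ eq))

-- Recursion is on the length, since the remaining list is reindexed by map.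
canonicalize : ∀ {ℓ} (M : ZeroOneMatrix k) (ps : List (Position k)) → length ps ≡ ℓ →
  Unique ps → (∀ p → p ∈ ps ⇔ NonCanonicalEntry M p) →
  Σ[ m ∈ ℕ ] Σ[ N ∈ ZeroOneMatrix m ] (M ⟶[ ps ] N × Canonical N)
-- The list holds all noncanonical entries, so when it is empty no 1 can violate the condition;
-- decidability removes the double negation.
canonicalize M [] _ _ ps⇔ = _ , M , done , λ x y Mxy≡1 →
  decidable-stable (canonicityCondition? M (x , y))
    λ ¬cc → contradiction (from (ps⇔ (x , y)) (Mxy≡1 , ¬cc)) λ ()
  where open Equivalence
canonicalize {ℓ = suc ℓ} M (p ∷ ps) eq (p∉ps ∷ ps!) ps⇔ =
  let m , N , steps , canonical =
        canonicalize {ℓ = ℓ} (Δn M p) (map injectPosition ps)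
          (trans (length-map injectPosition ps) (suc-injective eq))
          (map⁺ injectPosition-injective ps!)
          (λ q′ → mk⇔ (sound q′) (complete q′))
  in m , N , step p-nonCanonical steps , canonical
  where
  open Equivalence

  p-nonCanonical : NonCanonicalEntry M p
  p-nonCanonical = to (ps⇔ p) (here refl)

  -- Uniqueness is what separates `q` from the treated `p`, so `q` remains noncanonical after the
  -- step.
  sound : ∀ q′ → q′ ∈ map injectPosition ps → NonCanonicalEntry (Δn M p) q′
  sound q′ q′∈ with q , q∈ps , refl ← ∈-map⁻ injectPosition q′∈ =
    Δn-nonCanonical⁺ M (proj₁ p-nonCanonical) (lookup p∉ps q∈ps ∘ sym)
      (to (ps⇔ q) (there q∈ps))

  -- Such an entry comes from a noncanonical `q` of `M` other than `p`; being listed but not the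
  -- head, `q` lies in the tail.
  complete : ∀ q′ → NonCanonicalEntry (Δn M p) q′ → q′ ∈ map injectPosition ps
  complete q′ nc′
    with q , refl , q≢p , nc ← Δn-nonCanonical⁻ M (proj₁ p-nonCanonical) {q′} nc′
    with from (ps⇔ q) nc
  ... | here q≡p   = contradiction q≡p q≢p
  ... | there q∈ps = ∈-map⁺ injectPosition q∈ps

theorem7 : ∀ (n : ℕ) (L : ZeroOneMatrix n) →
    Σ[ ps ∈ List (Position n) ]
    ((∀ (p : Position n) → p ∈ ps ⇔ NonCanonicalEntry L p) ×
    (Σ[ m ∈ ℕ ] Σ[ N ∈ ZeroOneMatrix m ] (L ⟶[ ps ] N × Canonical N)))
theorem7 n L = ps , ps⇔ , canonicalize L ps refl ps! ps⇔
  where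
  -- This enumeration is exhaustive and free of repetitions; filtering it yields both the membership
  -- equivalence and the uniqueness that `canonicalize` requires.
  positions : List (Position n)
  positions = cartesianProduct (allFin n) (allFin n)

  ps : List (Position n)
  ps = filter (nonCanonicalEntry? L) positions

  ps! : Unique ps
  ps! = filter⁺ (nonCanonicalEntry? L) (cartesianProduct⁺ (allFin⁺ n) (allFin⁺ n))

  ps⇔ : ∀ p → p ∈ ps ⇔ NonCanonicalEntry L p
  ps⇔ (x , y) = mk⇔
    (λ p∈ps → proj₂ (∈-filter⁻ (nonCanonicalEntry? L) {xs = positions} p∈ps))
    (∈-filter⁺ (nonCanonicalEntry? L) (∈-cartesianProduct⁺ (∈-allFin x) (∈-allFin y)))
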